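{- Let $P=\forall x_1,\dots,x_n\,\exists y_1(D_1),\dots,y_k(D_k)$ be a topologically sorted prefix for $X$ and $Y$, let $G_{\mathrm{syn}}$ be an admissible group w.r.t. $P$, and let $G\subseteq G_{\mathrm{syn}}$ be a finite subset such that for all $g\in G$ and all $i,j\in\{1,\dots,k\}$: (1) $g(x)\in\operatorname{BF}(D_i)$ for all $x\in D_i$; (2) $g(y_i)\in\operatorname{BF}(\{y_j\mid D_j=D_i\})$; (3) if $D_i$ and $D_j$ are incomparable (neither $D_i\subseteq D_j$ nor $D_j\subseteq D_i$) and $g(y_i)\neq y_i$, then $g(y_j)=y_j$ and $g(x)=x$ for all $x\in D_j\setminus D_i$. Then \[\psi=\bigwedge_{g\in G}\bigwedge_{i=1}^{k}\Big(\Big(\bigwedge_{x\in D_i}(x\leftrightarrow g(x))\wedge\bigwedge_{j<i}(y_j\leftrightarrow g(y_j))\Big)\rightarrow\big(y_i\rightarrow g(y_i)\big)\Big)\] is a conjunctive symmetry breaker for the associated group of $G_{\mathrm{syn}}$.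
   Context: $X=\{x_1,\dots,x_n\}$, $Y=\{y_1,\dots,y_k\}$ are finite disjoint sets of propositional variables; for $V\subseteq X\cup Y$, $\operatorname{BF}(V)$ is the set of propositional formulas over $V$ (built from $\top,\bot$, variables and connectives); $\mathcal A(V)$ is the set of assignments $\sigma:V\to\{\top,\bot\}$ and $[\phi]_\sigma$ the truth value. A prefix $P=\forall x_1,\dots,x_n\,\exists y_1(D_1),\dots,y_k(D_k)$ has dependency sets $D_j\subseteq X$; it is topologically sorted if $D_i\subsetneq D_j$ implies $i<j$. An interpretation is $s=(s_1,\dots,s_k)$ with $s_j:\{\top,\bot\}^{|D_j|}\to\{\top,\bot\}$; $\mathcal S(P)$ is the set of interpretations. For $\sigma\in\mathcal A(X)$, the induced assignment $\sigma_s\in\mathcal A(X\cup Y)$ equals $\sigma$ on $X$ and $\sigma_s(y_j)=s_j$ evaluated at the values of $\sigma$ on $D_j$ (variables in increasing index order). For a DQBF $P.\phi$ ($\phi\in\operatorname{BF}(X\cup Y)$), $[P.\phi]_s=\bigwedge_{\sigma\in\mathcal A(X)}[\phi]_{\sigma_s}$. For a function $g:\operatorname{BF}(V)\to\operatorname{BF}(V)$ and $\sigma\in\mathcal A(V)$, $g(\sigma)\in\mathcal A(V)$ is $g(\sigma)(v)=[g(v)]_\sigma$; $g$ preserves propositional satisfiability if $[g(\phi)]_\sigma=[\phi]_{g(\sigma)}$ for all $\sigma,\phi$. A formula in $\operatorname{BF}(Y)$ depends on $x_i$ if it contains some $y_j$ with $x_i\in D_j$. A bijection $g:\operatorname{BF}(X\cup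 Y)\to\operatorname{BF}(X\cup Y)$ is admissible w.r.t. $P$ if it preserves propositional satisfiability, $g(x_i)\in\operatorname{BF}(X)$ and $g(y_j)\in\operatorname{BF}(Y)$ for all $i,j$, and whenever $g(y_j)$ depends on $x_i$ then $g^{ -1}(x_i)\in\operatorname{BF}(D_j)$. An admissible group is a subgroup (under composition) of the group of all admissible functions. For admissible $g$ and $\sigma\in\mathcal A(X)$, $g(\sigma)\in\mathcal A(X)$ is defined by $g(\sigma)(x)=[g(x)]_\sigma$. The associated group $G_{\mathrm{sem}}$ of an admissible group $G_{\mathrm{syn}}$ is the set of all bijections $f:\mathcal S(P)\to\mathcal S(P)$ such that for every $s\in\mathcal S(P)$ and every $\sigma\in\mathcal A(X)$ there exists $g\in G_{\mathrm{syn}}$ with $g(\sigma)_{f(s)}=g(\sigma_s)$. Given a group $G_{\mathrm{sem}}$ of bijections of $\mathcal S(P)$, a formula $\psi\in\operatorname{BF}(X\cup Y)$ is a conjunctive symmetry breaker for $G_{\mathrm{sem}}$ if for every $s\in\mathcal S(P)$ there is $g\in G_{\mathrm{sem}}$ with $[P.\psi]_{g(s)}=\top$. -}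

module Defs where

open import Data.Bool.Base using (Bool; true; false; not; _∧_; _∨_; _xor_)
open import Data.Empty using (⊥)
open import Data.Fin.Base as Fin using (Fin; zero; suc)
open import Data.Fin.Properties as Fin using ()
open import Data.Fin.Subset using (Subset; inside; outside; _∈_; _⊈_; _⊂_; ∣_∣)
open import Data.Fin.Subset.Properties using (_∈?_)
open import Data.List.Base as List using (List; allFin; filter; foldr)
open import Data.Nat.Base using (ℕ; zero; suc)
open import Data.Product.Base using (∃-syntax; _×_)
open import Data.Sum.Base using (_⊎_; inj₁; inj₂; [_,_])
open import Data.Vec.Base as Vec using (Vec)
open import Data.Vec.Functional as Vector using ()
open import Function.Base using (_∘_; const)
open import Function.Bundles using (Inverse; _↔_)
open import Function.Construct.Composition using (_↔-∘_)
open import Function.Construct.Identity using (↔-id)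
open import Function.Construct.Symmetry using (↔-sym)
open import Level using (Level; 0ℓ)
open import Relation.Binary.Bundles using (Setoid)
open import Relation.Binary.Definitions using (_Respects_)
open import Relation.Binary.PropositionalEquality using (_≡_; refl; sym; trans; _≗_)
open import Relation.Unary using (Pred; ∅; U)

open Inverse using (to; from)

private
  variable
    n k : ℕ
    ℓ : Level

infix  8 ¬ᶠ_
infixr 7 _∧ᶠ_
infixr 6 _∨ᶠ_
infixr 5 _⇒ᶠ_
infix  4 _⇔ᶠ_

data Formula (V : Set) : Set where
  ⊤ᶠ ⊥ᶠ : Formula V
  var   : V → Formula V
  ¬ᶠ_   : Formula V → Formula V
  _∧ᶠ_ _∨ᶠ_ _⇒ᶠ_ _⇔ᶠ_ : Formula V → Formula V → Formula V

⋀ᶠ : {V : Set} → List (Formula V) → Formula V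
⋀ᶠ = foldr _∧ᶠ_ ⊤ᶠ

Assignment : Set → Set
Assignment V = V → Bool

⟦_⟧ : {V : Set} → Formula V → Assignment V → Bool
⟦ ⊤ᶠ ⟧     σ = true
⟦ ⊥ᶠ ⟧     σ = false
⟦ var v ⟧  σ = σ v
⟦ ¬ᶠ φ ⟧   σ = not (⟦ φ ⟧ σ)
⟦ φ ∧ᶠ χ ⟧ σ = ⟦ φ ⟧ σ ∧ ⟦ χ ⟧ σ
⟦ φ ∨ᶠ χ ⟧ σ = ⟦ φ ⟧ σ ∨ ⟦ χ ⟧ σ
⟦ φ ⇒ᶠ χ ⟧ σ = not (⟦ φ ⟧ σ) ∨ ⟦ χ ⟧ σ
⟦ φ ⇔ᶠ χ ⟧ σ = not (⟦ φ ⟧ σ xor ⟦ χ ⟧ σ)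

infix 4 _occursIn_ _∈BF_

_occursIn_ : {V : Set} → V → Formula V → Set
v occursIn ⊤ᶠ       = ⊥
v occursIn ⊥ᶠ       = ⊥
v occursIn var w    = v ≡ w
v occursIn ¬ᶠ φ     = v occursIn φ
v occursIn (φ ∧ᶠ χ) = v occursIn φ ⊎ v occursIn χ
v occursIn (φ ∨ᶠ χ) = v occursIn φ ⊎ v occursIn χ
v occursIn (φ ⇒ᶠ χ) = v occursIn φ ⊎ v occursIn χ
v occursIn (φ ⇔ᶠ χ) = v occursIn φ ⊎ v occursIn χ

-- Formulas over a subset W of the variables are not a separate type but a
-- subset of all formulas, so that BF(W) ⊆ BF(X ∪ Y) holds on the nose.
_∈BF_ : {V : Set} → Formula V → Pred V 0ℓ → Set
φ ∈BF W = ∀ v → v occursIn φ → W v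

-- X ∪ Y with X = {x₁,…,xₙ} and Y = {y₁,…,yₖ} disjoint.
Var : ℕ → ℕ → Set
Var n k = Fin n ⊎ Fin k

BF : ℕ → ℕ → Set
BF n k = Formula (Var n k)

x̂ : Fin n → BF n k
x̂ i = var (inj₁ i)

ŷ : Fin k → BF n k
ŷ j = var (inj₂ j)

-- Subsets of X, respectively Y, viewed as subsets of X ∪ Y.
⊆X : Pred (Fin n) 0ℓ → Pred (Var n k) 0ℓ
⊆X A = [ A , ∅ ]

⊆Y : Pred (Fin k) 0ℓ → Pred (Var n k) 0ℓ
⊆Y B = [ ∅ , B ]

-- The prefix ∀ x₁,…,xₙ ∃ y₁(D₁),…,yₖ(Dₖ), given by j ↦ Dⱼ.
Prefix : ℕ → ℕ → Set
Prefix n k = Fin k → Subset n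

TopologicallySorted : Prefix n k → Set
TopologicallySorted D = ∀ i j → D i ⊂ D j → i Fin.< j

Incomparable : Subset n → Subset n → Set
Incomparable A B = A ⊈ B × B ⊈ A

Interpretation : Prefix n k → Set
Interpretation D = ∀ j → Vec Bool ∣ D j ∣ → Bool

-- Equality of interpretations is equality of their values.
interpretations : Prefix n k → Setoid 0ℓ 0ℓ
interpretations D = record
  { Carrier       = Interpretation D
  ; _≈_           = λ s t → ∀ j → s j ≗ t j
  ; isEquivalence = record
    { refl  = λ j v → refl
    ; sym   = λ p j v → sym (p j v)
    ; trans = λ p q j v → trans (p j v) (q j v)
    }
  }

restrict : (A : Subset n) → Assignment (Fin n) → Vec Bool ∣ A ∣
restrict Vec.[]              σ = Vec.[]
restrict (inside  Vec.∷ A) σ = σ zero Vec.∷ restrict A (σ ∘ suc)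
restrict (outside Vec.∷ A) σ = restrict A (σ ∘ suc)

induced : (D : Prefix n k) → Interpretation D → Assignment (Fin n) → Assignment (Var n k)
induced D s σ = [ σ , (λ j → s j (restrict (D j) σ)) ]

assignments : ∀ n → List (Assignment (Fin n))
assignments zero    = Vector.[] List.∷ List.[]
assignments (suc n) =
  List.map (true Vector.∷_) (assignments n) List.++ List.map (false Vector.∷_) (assignments n)

-- The truth value [P.φ]ₛ.
⟦_∙_⟧ : (D : Prefix n k) → BF n k → Interpretation D → Bool
⟦_∙_⟧ {n = n} D φ s = List.all (λ σ → ⟦ φ ⟧ (induced D s σ)) (assignments n)

FormulaBijection : ℕ → ℕ → Set
FormulaBijection n k = BF n k ↔ BF n k

act : FormulaBijection n k → Assignment (Var n k) → Assignment (Var n k)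
act g σ v = ⟦ to g (var v) ⟧ σ

-- g(σ) for σ ∈ 𝒜(X).  The extension of σ to Y by false is a dummy: for
-- admissible g the formula g(x) lies in BF(X), so its value depends on σ only.
actX : FormulaBijection n k → Assignment (Fin n) → Assignment (Fin n)
actX g σ i = ⟦ to g (x̂ i) ⟧ [ σ , const false ]

PreservesSatisfiability : FormulaBijection n k → Set
PreservesSatisfiability g = ∀ σ φ → ⟦ to g φ ⟧ σ ≡ ⟦ φ ⟧ (act g σ)

DependsOn : Prefix n k → BF n k → Fin n → Set
DependsOn D φ i = ∃[ j ] (inj₂ j occursIn φ × i ∈ D j)

record Admissible (D : Prefix n k) (g : FormulaBijection n k) : Set where
  field
    preservesSat : PreservesSatisfiability g
    x-closed     : ∀ i → to g (x̂ i) ∈BF ⊆X U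
    y-closed     : ∀ j → to g (ŷ j) ∈BF ⊆Y U
    dependencies : ∀ i j → DependsOn D (to g (ŷ j)) i → from g (x̂ i) ∈BF ⊆X (_∈ D j)

record IsAdmissibleGroup (D : Prefix n k) (G : Pred (FormulaBijection n k) ℓ) : Set ℓ where
  field
    admissible : ∀ {g} → G g → Admissible D g
    -- Members of G are functions up to extensional equality.
    respects   : G Respects (λ g h → to g ≗ to h)
    id-closed  : G (↔-id _)
    ∘-closed   : ∀ {g h} → G g → G h → G (g ↔-∘ h)
    ⁻¹-closed  : ∀ {g} → G g → G (↔-sym g)

InterpretationBijection : Prefix n k → Set
InterpretationBijection D = Inverse (interpretations D) (interpretations D)

AssociatedGroup : (D : Prefix n k) → Pred (FormulaBijection n k) ℓ → Pred (InterpretationBijection D) ℓ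
AssociatedGroup D G f =
  ∀ s σ → ∃[ g ] (G g × induced D (to f s) (actX g σ) ≗ act g (induced D s σ))

ConjunctiveSymmetryBreaker : (D : Prefix n k) → Pred (InterpretationBijection D) ℓ → BF n k → Set ℓ
ConjunctiveSymmetryBreaker D G ψ = ∀ s → ∃[ g ] (G g × ⟦ D ∙ ψ ⟧ (to g s) ≡ true)

breaker : Prefix n k → List (FormulaBijection n k) → BF n k
breaker {n} {k} D G =
  ⋀ᶠ (List.map (λ g → ⋀ᶠ (List.map (λ i →
    (⋀ᶠ (List.map (λ x → x̂ x ⇔ᶠ to g (x̂ x)) (filter (_∈? D i) (allFin n)))
      ∧ᶠ ⋀ᶠ (List.map (λ j → ŷ j ⇔ᶠ to g (ŷ j)) (filter (Fin._<? i) (allFin k))))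
    ⇒ᶠ (ŷ i ⇒ᶠ to g (ŷ i)))
    (allFin k))) G)

{-# OPTIONS --safe #-}

-- Suppose the conjunct of ψ for g ∈ G and i is false for s at σ.  Apply g to s
-- on the cone of all assignments that agree with σ on Dᵢ, and nothing elsewhere:
-- the cone is stable under g, conditions (2) and (3) ensure that only the yⱼ with
-- Dᵢ ⊆ Dⱼ are affected, and the dependency condition makes the result a
-- well-defined interpretation.  Because of the topological sorting, s₁,…,sᵢ₋₁ are
-- unchanged, while sᵢ changes from true to false at σ and nowhere else.  Hence the
-- numbers of satisfying arguments of s₁,…,sₖ decrease lexicographically, and
-- iterating leads to an interpretation t that satisfies ψ.  The transposition
-- of s and t belongs to the associated group.
module Submission where

open import Defs
open import Data.Bool.Base as Bool using (Bool; true; false; not; _∧_; _∨_; _xor_; f≤t; b≤b)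
open import Data.Bool.Properties as Bool using ()
open import Data.Fin.Base as Fin using (Fin; zero; suc)
open import Data.Fin.Properties as Fin using (all?)
open import Data.Fin.Subset using (Subset; inside; outside; _∈_; _∉_; _⊆_; _⊂_; ∣_∣)
open import Data.Fin.Subset.Properties using (_∈?_; _⊆?_; _⊂?_; ⊆-refl)
open import Data.List.Base as List using (List; []; _∷_; allFin; filter)
open import Data.List.Membership.Propositional using () renaming (_∈_ to _∈ˡ_)
open import Data.List.Membership.Propositional.Properties using (∈-filter⁺; ∈-allFin)
open import Data.List.Relation.Unary.Any using (here; there)
open import Data.Nat.Base as ℕ using (ℕ; zero; suc; z≤n; s≤s)
open import Data.Nat.Induction using (<-wellFounded)
open import Data.Nat.Properties using (+-mono-≤; +-mono-<-≤; +-mono-≤-<; <-resp₂-≡; ≤-refl; <-asym; <-irrefl)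
open import Data.Product.Base using (∃-syntax; _×_; _,_; proj₁; proj₂)
open import Data.Sum.Base using (_⊎_; inj₁; inj₂; [_,_])
open import Data.Vec.Base as Vec using (Vec; []; _∷_; tabulate)
open import Data.Vec.Relation.Binary.Lex.Strict as Lex using (Lex-<; this; next)
open import Function.Base using (_∘_; const)
open import Function.Bundles using (Inverse)
open import Function.Construct.Composition using (_↔-∘_)
open import Function.Construct.Identity using (↔-id)
open import Function.Construct.Symmetry using (↔-sym)
open import Induction.WellFounded using (Acc; acc; WellFounded)
open import Level using (Level; 0ℓ)
open import Relation.Binary.Bundles using (Setoid)
open import Relation.Binary.Definitions using (Decidable)
open import Relation.Binary.PropositionalEquality using (_≡_; _≢_; _≗_; refl; sym; trans; cong; cong₂; subst; module ≡-Reasoning)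
open import Relation.Nullary using (¬_; Dec; yes; no; contradiction)
open import Relation.Nullary.Decidable using (map′; _×-dec_; _→-dec_)
open import Relation.Unary using (Pred)
open Inverse using (to; from)

private
  variable
    n k m : ℕ
    ℓ : Level
    V : Set

-- Formulas

⟦⟧-cong : (φ : Formula V) {σ τ : Assignment V} →
  (∀ v → v occursIn φ → σ v ≡ τ v) → ⟦ φ ⟧ σ ≡ ⟦ φ ⟧ τ
⟦⟧-cong ⊤ᶠ       e = refl
⟦⟧-cong ⊥ᶠ       e = refl
⟦⟧-cong (var v)  e = e v refl
⟦⟧-cong (¬ᶠ φ)   e = cong not (⟦⟧-cong φ e)
⟦⟧-cong (φ ∧ᶠ χ) e = cong₂ _∧_ (⟦⟧-cong φ (λ v → e v ∘ inj₁)) (⟦⟧-cong χ (λ v → e v ∘ inj₂))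
⟦⟧-cong (φ ∨ᶠ χ) e = cong₂ _∨_ (⟦⟧-cong φ (λ v → e v ∘ inj₁)) (⟦⟧-cong χ (λ v → e v ∘ inj₂))
⟦⟧-cong (φ ⇒ᶠ χ) e = cong₂ (λ a b → not a ∨ b)
  (⟦⟧-cong φ (λ v → e v ∘ inj₁)) (⟦⟧-cong χ (λ v → e v ∘ inj₂))
⟦⟧-cong (φ ⇔ᶠ χ) e = cong₂ (λ a b → not (a xor b))
  (⟦⟧-cong φ (λ v → e v ∘ inj₁)) (⟦⟧-cong χ (λ v → e v ∘ inj₂))

⟦⟧-cong-BF : (φ : Formula V) {W : Pred V 0ℓ} {σ τ : Assignment V} →
  φ ∈BF W → (∀ v → W v → σ v ≡ τ v) → ⟦ φ ⟧ σ ≡ ⟦ φ ⟧ τ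
⟦⟧-cong-BF φ φ∈W e = ⟦⟧-cong φ (λ v v∈φ → e v (φ∈W v v∈φ))

-- Separates off the formulas without variables, whose value is constant; `g⁻¹-x-closed` excludes
-- this case for g(yᵢ).
hasVariable? : (φ : Formula V) → (∃[ v ] v occursIn φ) ⊎ (∀ v → ¬ v occursIn φ)
hasVariable?₂ : (φ χ : Formula V) →
  (∃[ v ] (v occursIn φ ⊎ v occursIn χ)) ⊎ (∀ v → ¬ (v occursIn φ ⊎ v occursIn χ))

hasVariable? ⊤ᶠ       = inj₂ λ _ ()
hasVariable? ⊥ᶠ       = inj₂ λ _ ()
hasVariable? (var v)  = inj₁ (v , refl)
hasVariable? (¬ᶠ φ)   = hasVariable? φ
hasVariable? (φ ∧ᶠ χ) = hasVariable?₂ φ χ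
hasVariable? (φ ∨ᶠ χ) = hasVariable?₂ φ χ
hasVariable? (φ ⇒ᶠ χ) = hasVariable?₂ φ χ
hasVariable? (φ ⇔ᶠ χ) = hasVariable?₂ φ χ

hasVariable?₂ φ χ with hasVariable? φ | hasVariable? χ
... | inj₁ (v , v∈φ) | _              = inj₁ (v , inj₁ v∈φ)
... | inj₂ _         | inj₁ (v , v∈χ) = inj₁ (v , inj₂ v∈χ)
... | inj₂ ∉φ        | inj₂ ∉χ        = inj₂ λ v → [ ∉φ v , ∉χ v ]

⋀-true⁻ : {A : Set} (f : A → Formula V) (xs : List A) {σ : Assignment V} →
  ⟦ ⋀ᶠ (List.map f xs) ⟧ σ ≡ true → ∀ {x} → x ∈ˡ xs → ⟦ f x ⟧ σ ≡ true
⋀-true⁻ f (x ∷ xs) {σ} eq x∈ with ⟦ f x ⟧ σ in fx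
⋀-true⁻ f (x ∷ xs) eq (here refl) | true = fx
⋀-true⁻ f (x ∷ xs) eq (there x∈)  | true = ⋀-true⁻ f xs eq x∈

⋀-false⁻ : {A : Set} (f : A → Formula V) (xs : List A) {σ : Assignment V} →
  ⟦ ⋀ᶠ (List.map f xs) ⟧ σ ≡ false → ∃[ x ] (x ∈ˡ xs × ⟦ f x ⟧ σ ≡ false)
⋀-false⁻ f (x ∷ xs) {σ} eq with ⟦ f x ⟧ σ in fx
... | false = x , here refl , fx
... | true  = let y , y∈ , fy = ⋀-false⁻ f xs eq in y , there y∈ , fy

all-false⁻ : {A : Set} (p : A → Bool) (xs : List A) →
  List.all p xs ≡ false → ∃[ x ] p x ≡ false
all-false⁻ p (x ∷ xs) eq with p x in px
... | false = x , px
... | true  = all-false⁻ p xs eq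

∧-true⁻ : ∀ a b → a ∧ b ≡ true → a ≡ true × b ≡ true
∧-true⁻ true true eq = refl , refl

⇒-false⁻ : ∀ a b → not a ∨ b ≡ false → a ≡ true × b ≡ false
⇒-false⁻ true false eq = refl , refl

⇔-true⁻ : ∀ a b → not (a xor b) ≡ true → a ≡ b
⇔-true⁻ true  true  eq = refl
⇔-true⁻ false false eq = refl

-- Assignments to subsets of the universal variables

infix 4 _≗[_]_

_≗[_]_ : Assignment (Fin n) → Subset n → Assignment (Fin n) → Set
σ ≗[ A ] τ = ∀ x → x ∈ A → σ x ≡ τ x

agree? : (A : Subset n) (σ τ : Assignment (Fin n)) → Dec (σ ≗[ A ] τ)
agree? A σ τ = all? λ x → (x ∈? A) →-dec (σ x Bool.≟ τ x)

restrict-cong : (A : Subset n) {σ τ : Assignment (Fin n)} →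
  σ ≗[ A ] τ → restrict A σ ≡ restrict A τ
restrict-cong []            e = refl
restrict-cong (inside ∷ A)  e =
  cong₂ _∷_ (e zero Vec.here) (restrict-cong A (λ x → e (suc x) ∘ Vec.there))
restrict-cong (outside ∷ A) e = restrict-cong A (λ x → e (suc x) ∘ Vec.there)

-- The value `false` off `A` is arbitrary: later uses depend only on the values on `A`.
extend : (A : Subset n) → Vec Bool ∣ A ∣ → Assignment (Fin n)
extend (inside  ∷ A) (b ∷ v) zero    = b
extend (inside  ∷ A) (b ∷ v) (suc x) = extend A v x
extend (outside ∷ A) v       zero    = false
extend (outside ∷ A) v       (suc x) = extend A v x

restrict-extend : (A : Subset n) (v : Vec Bool ∣ A ∣) → restrict A (extend A v) ≡ v
restrict-extend []            []      = refl
restrict-extend (inside  ∷ A) (b ∷ v) = cong (b ∷_) (restrict-extend A v)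
restrict-extend (outside ∷ A) v       = restrict-extend A v

extend-restrict : (A : Subset n) (σ : Assignment (Fin n)) → extend A (restrict A σ) ≗[ A ] σ
extend-restrict (inside  ∷ A) σ zero    _              = refl
extend-restrict (inside  ∷ A) σ (suc x) (Vec.there x∈) = extend-restrict A (σ ∘ suc) x x∈
extend-restrict (outside ∷ A) σ (suc x) (Vec.there x∈) = extend-restrict A (σ ∘ suc) x x∈

⊆∧⊄⇒⊇ : {A B : Subset n} → A ⊆ B → ¬ A ⊂ B → B ⊆ A
⊆∧⊄⇒⊇ {A = A} A⊆B A⊄B {x} x∈B with x ∈? A
... | yes x∈A = x∈A
... | no  x∉A = contradiction ((λ {y} → A⊆B {y}) , x , x∈B , x∉A) A⊄B

-- Counting satisfying arguments

trues : (Vec Bool m → Bool) → ℕ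
trues {zero}  f = Bool.if f [] then 1 else 0
trues {suc m} f = trues (f ∘ (true ∷_)) ℕ.+ trues (f ∘ (false ∷_))

trues-mono-≤ : {f g : Vec Bool m → Bool} → (∀ v → f v Bool.≤ g v) → trues f ℕ.≤ trues g
trues-mono-≤ {zero} {f} {g} f≤g with f [] | g [] | f≤g []
... | _ | _ | f≤t = z≤n
... | _ | _ | b≤b = ≤-refl
trues-mono-≤ {suc m} f≤g =
  +-mono-≤ (trues-mono-≤ (f≤g ∘ (true ∷_))) (trues-mono-≤ (f≤g ∘ (false ∷_)))

trues-mono-< : {f g : Vec Bool m → Bool} → (∀ v → f v Bool.≤ g v) →
  ∀ v → f v ≡ false → g v ≡ true → trues f ℕ.< trues g
trues-mono-< f≤g [] fv gv rewrite fv | gv = ≤-refl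
trues-mono-< f≤g (true  ∷ v) fv gv =
  +-mono-<-≤ (trues-mono-< (f≤g ∘ (true ∷_)) v fv gv) (trues-mono-≤ (f≤g ∘ (false ∷_)))
trues-mono-< f≤g (false ∷ v) fv gv =
  +-mono-≤-< (trues-mono-≤ (f≤g ∘ (true ∷_))) (trues-mono-< (f≤g ∘ (false ∷_)) v fv gv)

trues-cong : {f g : Vec Bool m → Bool} → f ≗ g → trues f ≡ trues g
trues-cong {zero}  e rewrite e [] = refl
trues-cong {suc m} e = cong₂ ℕ._+_ (trues-cong (e ∘ (true ∷_))) (trues-cong (e ∘ (false ∷_)))

infix 4 _<ₗₑₓ_

_<ₗₑₓ_ : Vec ℕ k → Vec ℕ k → Set
_<ₗₑₓ_ = Lex-< _≡_ ℕ._<_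

-- Entries after `i` are left unconstrained because repairing a conjunct for yᵢ may increase the
-- later counts.
tabulate-<ₗₑₓ : {f g : Fin k → ℕ} (i : Fin k) →
  (∀ j → j Fin.< i → f j ≡ g j) → f i ℕ.< g i → tabulate f <ₗₑₓ tabulate g
tabulate-<ₗₑₓ zero    eq lt = this lt refl
tabulate-<ₗₑₓ (suc i) eq lt =
  next (eq zero (s≤s z≤n)) (tabulate-<ₗₑₓ i (λ j j<i → eq (suc j) (s≤s j<i)) lt)

measure : (D : Prefix n k) → Interpretation D → Vec ℕ k
measure D s = tabulate (λ j → trues (s j))

-- Transpositions

module _ {c r} (S : Setoid c r) (_≈?_ : Decidable (Setoid._≈_ S)) (a b : Setoid.Carrier S) where

  open Setoid S renaming (refl to ≈-refl; sym to ≈-sym; trans to ≈-trans)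

  swap : Carrier → Carrier
  swap t with t ≈? a
  ... | yes _ = b
  ... | no  _ with t ≈? b
  ...   | yes _ = a
  ...   | no  _ = t

  -- Having `≡` here rather than `≈` lets the truth value of a formula be carried over by `cong`.
  swap-a : swap a ≡ b
  swap-a with a ≈? a
  ... | yes _   = refl
  ... | no  a≉a = contradiction ≈-refl a≉a

  -- The graph of `swap`, so that the laws below follow by matching on cases instead of unfolding
  -- nested decisions.
  data Swapped (t : Carrier) : Carrier → Set r where
    at-a      : t ≈ a → Swapped t b
    at-b      : t ≈ b → Swapped t a
    elsewhere : ¬ t ≈ a → ¬ t ≈ b → Swapped t t

  swapped : ∀ t → Swapped t (swap t)
  swapped t with t ≈? a
  ... | yes t≈a = at-a t≈a
  ... | no  t≉a with t ≈? b
  ...   | yes t≈b = at-b t≈b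
  ...   | no  t≉b = elsewhere t≉a t≉b

  -- The points `a` and `b` may coincide. In the two mixed cases one class contains both, so the
  -- outputs `a` and `b` agree up to `≈`.
  Swapped-cong : ∀ {t u t′ u′} → t ≈ u → Swapped t t′ → Swapped u u′ → t′ ≈ u′
  Swapped-cong e (at-a p)        (at-a q)        = ≈-refl
  Swapped-cong e (at-a p)        (at-b q)        = ≈-trans (≈-sym q) (≈-trans (≈-sym e) p)
  Swapped-cong e (at-a p)        (elsewhere q _) = contradiction (≈-trans (≈-sym e) p) q
  Swapped-cong e (at-b p)        (at-a q)        = ≈-trans (≈-sym q) (≈-trans (≈-sym e) p)
  Swapped-cong e (at-b p)        (at-b q)        = ≈-refl
  Swapped-cong e (at-b p)        (elsewhere _ q) = contradiction (≈-trans (≈-sym e) p) q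
  Swapped-cong e (elsewhere p _) (at-a q)        = contradiction (≈-trans e q) p
  Swapped-cong e (elsewhere _ p) (at-b q)        = contradiction (≈-trans e q) p
  Swapped-cong e (elsewhere _ _) (elsewhere _ _) = e

  swap-cong : ∀ {t u} → t ≈ u → swap t ≈ swap u
  swap-cong e = Swapped-cong e (swapped _) (swapped _)

  Swapped-involutive : ∀ {t u w} → Swapped t u → Swapped u w → w ≈ t
  Swapped-involutive (at-a p)        (at-a q)        = ≈-trans q (≈-sym p)
  Swapped-involutive (at-a p)        (at-b _)        = ≈-sym p
  Swapped-involutive (at-a p)        (elsewhere _ q) = contradiction ≈-refl q
  Swapped-involutive (at-b p)        (at-a _)        = ≈-sym p
  Swapped-involutive (at-b p)        (at-b q)        = ≈-trans q (≈-sym p)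
  Swapped-involutive (at-b p)        (elsewhere q _) = contradiction ≈-refl q
  Swapped-involutive (elsewhere p _) (at-a q)        = contradiction q p
  Swapped-involutive (elsewhere _ p) (at-b q)        = contradiction q p
  Swapped-involutive (elsewhere _ _) (elsewhere _ _) = ≈-refl

  transposition : Inverse S S
  transposition = record
    { to        = swap
    ; from      = swap
    ; to-cong   = swap-cong
    ; from-cong = swap-cong
    ; inverse   = swap-inverse , swap-inverse
    }
    where
    swap-inverse : ∀ {x y} → y ≈ swap x → swap y ≈ x
    swap-inverse e =
      ≈-trans (swap-cong e) (Swapped-involutive (swapped _) (swapped _))

-- Decidable equality of interpretations

allVec? : {P : Pred (Vec Bool m) ℓ} → (∀ v → Dec (P v)) → Dec (∀ v → P v)
allVec? {zero}  P? = map′ (λ { p [] → p }) (λ p → p []) (P? [])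
allVec? {suc m} P? = map′
  (λ { (p , q) (true ∷ v) → p v ; (p , q) (false ∷ v) → q v })
  (λ p → (p ∘ (true ∷_)) , (p ∘ (false ∷_)))
  (allVec? (P? ∘ (true ∷_)) ×-dec allVec? (P? ∘ (false ∷_)))

interpretations-≟ : (D : Prefix n k) → Decidable (Setoid._≈_ (interpretations D))
interpretations-≟ D s t = all? λ j → allVec? λ v → s j v Bool.≟ t j v

-- The action of admissible functions

-- Preservation for `g` is applied to the formula h(v). The action on assignments reverses the
-- order: `g` acts first.
act-∘ : (g h : FormulaBijection n k) → PreservesSatisfiability g →
  ∀ σ → act (g ↔-∘ h) σ ≗ act h (act g σ)
act-∘ g h pg σ v = pg σ (to h (var v))

-- Preservation for g⁻¹ is applied to the formula g(v), which g⁻¹ takes back to v.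
act-inverse : (g : FormulaBijection n k) → PreservesSatisfiability (↔-sym g) →
  ∀ σ → act g (act (↔-sym g) σ) ≗ σ
act-inverse g pg⁻¹ σ v =
  trans (sym (pg⁻¹ σ (to g (var v)))) (cong (λ φ → ⟦ φ ⟧ σ) (Inverse.strictlyInverseʳ g (var v)))

act-cong : (g : FormulaBijection n k) {σ τ : Assignment (Var n k)} →
  σ ≗ τ → act g σ ≗ act g τ
act-cong g e v = ⟦⟧-cong (to g (var v)) (λ w _ → e w)

Transports : (D : Prefix n k) → FormulaBijection n k → Interpretation D → Interpretation D →
  Assignment (Fin n) → Set
Transports D g s t σ = induced D t (actX g σ) ≗ act g (induced D s σ)

-- AssociatedGroup D G f unfolds to ∀ s → Related D G s (to f s).
-- The relation need not be symmetric, as g may vary with σ: σ ↦ g(σ) need not be onto.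
Related : (D : Prefix n k) → Pred (FormulaBijection n k) ℓ → Interpretation D → Interpretation D → Set ℓ
Related D G s t = ∀ σ → ∃[ g ] (G g × Transports D g s t σ)

module _ {D : Prefix n k} where

  open Admissible

  -- As g(x) lies in BF(X), the dummy values that `actX` puts on Y are never read.
  act-x : ∀ {g} → Admissible D g → ∀ ρ x → act g ρ (inj₁ x) ≡ actX g (ρ ∘ inj₁) x
  act-x {g} ag ρ x = ⟦⟧-cong-BF (to g (x̂ x)) (x-closed ag x) λ { (inj₁ _) _ → refl }

  actX-∘ : ∀ {g h} → Admissible D g → Admissible D h →
    ∀ σ → actX (g ↔-∘ h) σ ≗ actX h (actX g σ)
  actX-∘ {g} {h} ag ah σ x = trans (act-∘ g h (preservesSat ag) _ (inj₁ x)) (act-x ah _ x)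

  actX-inverse : ∀ {g} → Admissible D g → Admissible D (↔-sym g) →
    ∀ σ → actX g (actX (↔-sym g) σ) ≗ σ
  actX-inverse {g} ag ag⁻¹ σ x =
    trans (sym (act-x ag _ x)) (act-inverse g (preservesSat ag⁻¹) _ (inj₁ x))

  open Setoid (interpretations D) using (_≈_)

  induced-cong : ∀ s {σ τ} → σ ≗ τ → induced D s σ ≗ induced D s τ
  induced-cong s e (inj₁ x) = e x
  induced-cong s e (inj₂ j) = cong (s j) (restrict-cong (D j) (λ x _ → e x))

  Transports-∘ : ∀ {g h} → Admissible D g → Admissible D h → ∀ s t u {σ} →
    Transports D g s t σ → Transports D h t u (actX g σ) → Transports D (g ↔-∘ h) s u σ
  Transports-∘ {g} {h} ag ah s t u {σ} st tu v = begin
    induced D u (actX (g ↔-∘ h) σ) v   ≡⟨ induced-cong u (actX-∘ ag ah σ) v ⟩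
    induced D u (actX h (actX g σ)) v  ≡⟨ tu v ⟩
    act h (induced D t (actX g σ)) v   ≡⟨ act-cong h st v ⟩
    act h (act g (induced D s σ)) v    ≡⟨ act-∘ g h (preservesSat ag) _ v ⟨
    act (g ↔-∘ h) (induced D s σ) v    ∎
    where open ≡-Reasoning

  Transports-⁻¹ : ∀ {g} → Admissible D g → Admissible D (↔-sym g) → ∀ s t {σ} →
    Transports D g s t (actX (↔-sym g) σ) → Transports D (↔-sym g) t s σ
  Transports-⁻¹ {g} ag ag⁻¹ s t {σ} st v = begin
    induced D s (actX g⁻¹ σ) v                     ≡⟨ act-inverse g⁻¹ (preservesSat ag) _ v ⟨
    act g⁻¹ (act g (induced D s (actX g⁻¹ σ))) v   ≡⟨ act-cong g⁻¹ st v ⟨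
    act g⁻¹ (induced D t (actX g (actX g⁻¹ σ))) v  ≡⟨ act-cong g⁻¹ (induced-cong t (actX-inverse ag ag⁻¹ σ)) v ⟩
    act g⁻¹ (induced D t σ) v                      ∎
    where
    open ≡-Reasoning
    g⁻¹ = ↔-sym g

  module _ {G : Pred (FormulaBijection n k) ℓ} (isGroup : IsAdmissibleGroup D G) where

    open IsAdmissibleGroup isGroup

    Related-reflexive : ∀ s t → s ≈ t → Related D G s t
    Related-reflexive s t s≈t σ =
      ↔-id _ , id-closed , λ { (inj₁ x) → refl ; (inj₂ j) → sym (s≈t j _) }

    Related-trans : ∀ s t u → Related D G s t → Related D G t u → Related D G s u
    Related-trans s t u st tu σ =
      let g , g∈ , p = st σ
          -- The second group element is chosen at g(σ), where the first one lands.
          h , h∈ , q = tu (actX g σ)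
      in g ↔-∘ h , ∘-closed g∈ h∈ , Transports-∘ (admissible g∈) (admissible h∈) s t u p q

    -- The identity serves every interpretation that is not moved. The transposition sends `s` to
    -- `t` and `t` to `s`, hence both directions.
    transposition-associated : ∀ s t → Related D G s t → Related D G t s →
      AssociatedGroup D G (transposition (interpretations D) (interpretations-≟ D) s t)
    transposition-associated s t st ts u = related (swapped (interpretations D) (interpretations-≟ D) s t u)
      where
      related : ∀ {w} → Swapped (interpretations D) (interpretations-≟ D) s t u w → Related D G u w
      related (at-a u≈s)      = Related-trans u s t (Related-reflexive u s u≈s) st
      related (at-b u≈t)      = Related-trans u t s (Related-reflexive u t u≈t) ts
      related (elsewhere _ _) = Related-reflexive u u (λ _ _ → refl)

-- Repairing a violated conjunct

record Violation (D : Prefix n k) (s : Interpretation D) (σ : Assignment (Fin n))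
                 (g : FormulaBijection n k) (i : Fin k) : Set where
  field
    x-fixed  : ∀ x → x ∈ D i → σ x ≡ act g (induced D s σ) (inj₁ x)
    y-fixed  : ∀ j → j Fin.< i → induced D s σ (inj₂ j) ≡ act g (induced D s σ) (inj₂ j)
    y-true   : induced D s σ (inj₂ i) ≡ true
    gy-false : act g (induced D s σ) (inj₂ i) ≡ false

breaker-false⁻ : (D : Prefix n k) (G : List (FormulaBijection n k)) (s : Interpretation D) →
  ⟦ D ∙ breaker D G ⟧ s ≡ false →
  ∃[ σ ] ∃[ g ] ∃[ i ] (g ∈ˡ G × Violation D s σ g i)
breaker-false⁻ {n} {k} D G s eq =
  let σ , ψ-false      = all-false⁻ (λ σ → ⟦ breaker D G ⟧ (induced D s σ)) (assignments n) eq
      g , g∈ , g-false = ⋀-false⁻ _ G ψ-false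
      i , _ , i-false  = ⋀-false⁻ _ (allFin k) g-false
      prem , concl     = ⇒-false⁻ _ _ i-false
      xs , ys          = ∧-true⁻ _ _ prem
      yt , gyf         = ⇒-false⁻ _ _ concl
  in σ , g , i , g∈ , record
    { x-fixed  = λ x x∈ → ⇔-true⁻ _ _
        (⋀-true⁻ _ (filter (_∈? D i) (allFin n)) xs (∈-filter⁺ (_∈? D i) (∈-allFin x) x∈))
    ; y-fixed  = λ j j<i → ⇔-true⁻ _ _
        (⋀-true⁻ _ (filter (Fin._<? i) (allFin k)) ys (∈-filter⁺ (Fin._<? i) (∈-allFin j) j<i))
    ; y-true   = yt
    ; gy-false = gyf
    }

module Repair
  {D : Prefix n k} (sorted : TopologicallySorted D)
  {g : FormulaBijection n k} (ag : Admissible D g) (ag⁻¹ : Admissible D (↔-sym g))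
  (cond₁ : ∀ i x → x ∈ D i → to g (x̂ x) ∈BF ⊆X (_∈ D i))
  (cond₂ : ∀ i → to g (ŷ i) ∈BF ⊆Y (λ j → D j ≡ D i))
  (cond₃ : ∀ i j → Incomparable (D i) (D j) → to g (ŷ i) ≢ ŷ i →
    to g (ŷ j) ≡ ŷ j × (∀ x → x ∈ D j → x ∉ D i → to g (x̂ x) ≡ x̂ x))
  {s : Interpretation D} {σ : Assignment (Fin n)} {i : Fin k} (violation : Violation D s σ g i)
  where

  open Admissible
  open Violation violation

  g⁻¹ : FormulaBijection n k
  g⁻¹ = ↔-sym g

  Cone : Assignment (Fin n) → Set
  Cone τ = τ ≗[ D i ] σ

  -- By (1), g(x) reads only Dᵢ, where τ agrees with σ; and g(σ) = σ on Dᵢ by the premise of the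
  -- violated conjunct.
  actX-cone : ∀ {τ} → Cone τ → Cone (actX g τ)
  actX-cone τ∈C x x∈ = trans
    (⟦⟧-cong-BF (to g (x̂ x)) (cond₁ i x x∈) λ { (inj₁ y) y∈ → τ∈C y y∈ })
    (sym (x-fixed x x∈))

  -- g(yᵢ) is not constant, since g is a bijection on assignments; so it contains
  -- some yⱼ, and Dⱼ = Dᵢ by (2).
  g⁻¹-x-closed : ∀ x → x ∈ D i → from g (x̂ x) ∈BF ⊆X (_∈ D i)
  g⁻¹-x-closed x x∈ with hasVariable? (to g (ŷ i))
  ... | inj₁ (inj₁ y , y∈φ) = contradiction (cond₂ i (inj₁ y) y∈φ) λ ()
  ... | inj₁ (inj₂ j , j∈φ) = dependencies ag x i
    (j , j∈φ , subst (x ∈_) (sym (cond₂ i (inj₂ j) j∈φ)) x∈)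
  ... | inj₂ ∉φ = contradiction
    (trans (sym (value (const true)))
      (trans (⟦⟧-cong (to g (ŷ i)) (λ v v∈ → contradiction v∈ (∉φ v))) (value (const false))))
    λ ()
    where
    value : ∀ ρ → ⟦ to g (ŷ i) ⟧ (act g⁻¹ ρ) ≡ ρ (inj₂ i)
    value ρ = act-inverse g (preservesSat ag⁻¹) ρ (inj₂ i)

  -- On Dᵢ, both τ and g(σ) equal σ. Since g⁻¹(x) reads only Dᵢ, g⁻¹(τ) agrees there with g⁻¹(g(σ))
  -- = σ.
  actX⁻¹-cone : ∀ {τ} → Cone τ → Cone (actX g⁻¹ τ)
  actX⁻¹-cone τ∈C x x∈ = trans
    (⟦⟧-cong-BF (from g (x̂ x)) (g⁻¹-x-closed x x∈)
      λ { (inj₁ y) y∈ → trans (τ∈C y y∈) (sym (actX-cone (λ _ _ → refl) y y∈)) })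
    (actX-inverse ag⁻¹ ag σ x)

  -- When Dᵢ ⊆ Dⱼ, the values on Dⱼ decide membership in the cone, so the case distinction can be
  -- made from the argument of sⱼ alone.
  Affected : (j : Fin k) → Vec Bool ∣ D j ∣ → Set
  Affected j v = D i ⊆ D j × Cone (extend (D j) v)

  affected? : ∀ j v → Dec (Affected j v)
  affected? j v = (D i ⊆? D j) ×-dec agree? (D i) (extend (D j) v) σ

  -- On affected arguments this is the value forced by transport along `g`: g⁻¹ recovers the source
  -- assignment, and yⱼ receives the value of g(yⱼ) there.
  repaired : Interpretation D
  repaired j v with affected? j v
  ... | yes _ = ⟦ to g (ŷ j) ⟧ (induced D s (actX g⁻¹ (extend (D j) v)))
  ... | no  _ = s j v

  repaired-affected : ∀ j v → Affected j v →
    repaired j v ≡ ⟦ to g (ŷ j) ⟧ (induced D s (actX g⁻¹ (extend (D j) v)))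
  repaired-affected j v a with affected? j v
  ... | yes _  = refl
  ... | no  ¬a = contradiction a ¬a

  repaired-unaffected : ∀ j v → ¬ Affected j v → repaired j v ≡ s j v
  repaired-unaffected j v ¬a with affected? j v
  ... | yes a = contradiction a ¬a
  ... | no  _ = refl

  -- This is the trigger for condition (3).
  gy≢y : to g (ŷ i) ≢ ŷ i
  gy≢y eq = contradiction
    (trans (sym y-true) (trans (cong (λ φ → ⟦ φ ⟧ (induced D s σ)) (sym eq)) gy-false)) λ ()

  -- Transport along `g` on the cone, by the position of Dⱼ relative to Dᵢ

  module _ {τ : Assignment (Fin n)} (τ∈C : Cone τ) (j : Fin k) where

    -- Well-definedness: if yₗ occurs in g(yⱼ) and x ∈ Dₗ, the dependency condition puts g⁻¹(x) in
    -- BF(Dⱼ). So the restriction of g(τ) to Dⱼ determines τ on Dₗ, which is all that sₗ reads.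
    repaired-⊇ : D i ⊆ D j →
      repaired j (restrict (D j) (actX g τ)) ≡ act g (induced D s τ) (inj₂ j)
    repaired-⊇ Di⊆Dj = trans
      (repaired-affected j _ (Di⊆Dj , λ x x∈ →
        trans (extend-restrict (D j) (actX g τ) x (Di⊆Dj x∈)) (actX-cone τ∈C x x∈)))
      (⟦⟧-cong (to g (ŷ j)) λ
        { (inj₁ y) y∈φ → contradiction (cond₂ j (inj₁ y) y∈φ) λ ()
        ; (inj₂ l) l∈φ → cong (s l) (restrict-cong (D l) λ x x∈ → trans
            (⟦⟧-cong-BF (from g (x̂ x)) (dependencies ag x j (l , l∈φ , x∈))
              λ { (inj₁ y) y∈ → extend-restrict (D j) (actX g τ) y y∈ })
            (actX-inverse ag⁻¹ ag τ x)) })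

    -- Sorting gives j < i, so yⱼ and g(yⱼ) agree at σ. By (2) both read only Dⱼ ⊆ Dᵢ, where σ, τ
    -- and g(τ) coincide.
    unchanged-⊂ : D j ⊂ D i →
      s j (restrict (D j) (actX g τ)) ≡ act g (induced D s τ) (inj₂ j)
    unchanged-⊂ Dj⊂Di@(Dj⊆Di , _) = begin
      s j (restrict (D j) (actX g τ))      ≡⟨ cong (s j) (restrict-cong (D j) λ x x∈ → actX-cone τ∈C x (Dj⊆Di x∈)) ⟩
      s j (restrict (D j) σ)               ≡⟨ y-fixed j (sorted j i Dj⊂Di) ⟩
      act g (induced D s σ) (inj₂ j)       ≡⟨ ⟦⟧-cong-BF (to g (ŷ j)) (cond₂ j) (λ { (inj₂ l) Dl≡Dj →
                                                cong (s l) (restrict-cong (D l) λ x x∈ →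
                                                  sym (τ∈C x (Dj⊆Di (subst (x ∈_) Dl≡Dj x∈)))) }) ⟩
      act g (induced D s τ) (inj₂ j)       ∎
      where open ≡-Reasoning

    -- Condition (3) fixes yⱼ and the variables of Dⱼ outside Dᵢ; on the rest of Dⱼ, both τ and g(τ)
    -- equal σ by the cone.
    unchanged-incomparable : Incomparable (D i) (D j) →
      s j (restrict (D j) (actX g τ)) ≡ act g (induced D s τ) (inj₂ j)
    unchanged-incomparable inc = trans
      (cong (s j) (restrict-cong (D j) fixes-τ))
      (cong (λ φ → ⟦ φ ⟧ (induced D s τ)) (sym gy≡y))
      where
      gy≡y = proj₁ (cond₃ i j inc gy≢y)
      gx≡x = proj₂ (cond₃ i j inc gy≢y)

      fixes-τ : actX g τ ≗[ D j ] τ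
      fixes-τ x x∈Dj with x ∈? D i
      ... | yes x∈Di = trans (actX-cone τ∈C x x∈Di) (sym (τ∈C x x∈Di))
      ... | no  x∉Di = cong (λ φ → ⟦ φ ⟧ [ τ , const false ]) (gx≡x x x∈Dj x∉Di)

    repaired-transports-y : repaired j (restrict (D j) (actX g τ)) ≡ act g (induced D s τ) (inj₂ j)
    repaired-transports-y = cases (D i ⊆? D j) (D j ⊂? D i)
      where
      cases : Dec (D i ⊆ D j) → Dec (D j ⊂ D i) →
        repaired j (restrict (D j) (actX g τ)) ≡ act g (induced D s τ) (inj₂ j)
      cases (yes Di⊆Dj) _           = repaired-⊇ Di⊆Dj
      cases (no  Di⊈Dj) (yes Dj⊂Di) = trans
        (repaired-unaffected j _ λ (Di⊆Dj , _) → Di⊈Dj Di⊆Dj)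
        (unchanged-⊂ Dj⊂Di)
      -- A non-strict inclusion Dⱼ ⊆ Dᵢ would give Dᵢ ⊆ Dⱼ, so the two sets are incomparable.
      cases (no  Di⊈Dj) (no  Dj⊄Di) = trans
        (repaired-unaffected j _ λ (Di⊆Dj , _) → Di⊈Dj Di⊆Dj)
        (unchanged-incomparable (Di⊈Dj , λ Dj⊆Di → Di⊈Dj (⊆∧⊄⇒⊇ Dj⊆Di Dj⊄Di)))

  transports : ∀ {τ} → Cone τ → Transports D g s repaired τ
  transports {τ} τ∈C (inj₁ x) = sym (act-x ag (induced D s τ) x)
  transports     τ∈C (inj₂ j) = repaired-transports-y τ∈C j

  repaired-outside : ∀ {τ} → ¬ Cone τ → ∀ j → repaired j (restrict (D j) τ) ≡ s j (restrict (D j) τ)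
  repaired-outside {τ} τ∉C j = repaired-unaffected j _ λ (Di⊆Dj , ext∈C) →
    τ∉C λ x x∈ → trans (sym (extend-restrict (D j) τ x (Di⊆Dj x∈))) (ext∈C x x∈)

  module _ {G : Pred (FormulaBijection n k) ℓ} (isGroup : IsAdmissibleGroup D G) (g∈G : G g) where

    open IsAdmissibleGroup isGroup using (id-closed; ⁻¹-closed)

    -- The group element may depend on the assignment: `g` on the cone, the identity off it.
    related-repaired : Related D G s repaired
    related-repaired τ with agree? (D i) τ σ
    ... | yes τ∈C = g , g∈G , transports τ∈C
    ... | no  τ∉C = ↔-id _ , id-closed , λ
      { (inj₁ x) → refl ; (inj₂ j) → repaired-outside τ∉C j }

    repaired-related : Related D G repaired s
    repaired-related τ with agree? (D i) τ σ
    ... | yes τ∈C = g⁻¹ , ⁻¹-closed g∈G ,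
      -- Inverting the transport at τ requires its source g⁻¹(τ) to lie in the cone as well.
      Transports-⁻¹ ag ag⁻¹ s repaired (transports (actX⁻¹-cone τ∈C))
    ... | no  τ∉C = ↔-id _ , id-closed , λ
      { (inj₁ x) → refl ; (inj₂ j) → sym (repaired-outside τ∉C j) }

  -- Unless i < j, sorting excludes Dᵢ ⊂ Dⱼ, so Dⱼ = Dᵢ and the cone leaves a single argument, that
  -- of σ. As g(σ) = σ on Dᵢ, transport from σ gives the new value at this very argument.
  affected⇒σ : ∀ {j v} → Affected j v → ¬ i Fin.< j →
    v ≡ restrict (D j) σ × repaired j v ≡ act g (induced D s σ) (inj₂ j)
  affected⇒σ {j} {v} (Di⊆Dj , ext∈C) i≮j =
    v≡σ , trans (cong (repaired j) (trans v≡σ σ≡gσ)) (transports (λ _ _ → refl) (inj₂ j))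
    where
    Dj⊆Di : D j ⊆ D i
    Dj⊆Di = ⊆∧⊄⇒⊇ Di⊆Dj (i≮j ∘ sorted i j)

    v≡σ : v ≡ restrict (D j) σ
    v≡σ = trans (sym (restrict-extend (D j) v)) (restrict-cong (D j) λ x x∈ → ext∈C x (Dj⊆Di x∈))

    σ≡gσ : restrict (D j) σ ≡ restrict (D j) (actX g σ)
    σ≡gσ = restrict-cong (D j) λ x x∈ → sym (actX-cone (λ _ _ → refl) x (Dj⊆Di x∈))

  repaired-below : ∀ j → j Fin.< i → repaired j ≗ s j
  repaired-below j j<i v = case (affected? j v)
    where
    case : Dec (Affected j v) → repaired j v ≡ s j v
    case (no  ¬a) = repaired-unaffected j v ¬a
    -- At the one affected argument the new value is that of g(yⱼ), which the premise of the
    -- conjunct equates with yⱼ.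
    case (yes a)  = let v≡σ , eq = affected⇒σ a (<-asym j<i) in
      trans eq (trans (sym (y-fixed j j<i)) (cong (s j) (sym v≡σ)))

  -- The only affected argument receives the value of g(yᵢ) at σ, which is false.
  repaired-≤ : ∀ v → repaired i v Bool.≤ s i v
  repaired-≤ v = case (affected? i v)
    where
    case : Dec (Affected i v) → repaired i v Bool.≤ s i v
    case (no  ¬a) = Bool.≤-reflexive (repaired-unaffected i v ¬a)
    case (yes a)  = subst (Bool._≤ s i v)
      (sym (trans (proj₂ (affected⇒σ a (<-irrefl refl))) gy-false)) (Bool.≤-minimum _)

  repaired-false : repaired i (restrict (D i) σ) ≡ false
  repaired-false = trans (proj₂ (affected⇒σ (⊆-refl , extend-restrict (D i) σ) (<-irrefl refl))) gy-false

  measure-decreases : measure D repaired <ₗₑₓ measure D s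
  measure-decreases = tabulate-<ₗₑₓ i
    (λ j j<i → trues-cong (repaired-below j j<i))
    (trues-mono-< repaired-≤ (restrict (D i) σ) repaired-false y-true)

-- Descent to an interpretation satisfying the symmetry breaker

theorem2 : ∀ {ℓ : Level} (n k : ℕ) (D : Prefix n k) → TopologicallySorted D →
    (Gsyn : Pred (FormulaBijection n k) ℓ) → IsAdmissibleGroup D Gsyn →
    (G : List (FormulaBijection n k)) → (∀ g → g ∈ˡ G → Gsyn g) →
    (∀ g → g ∈ˡ G → ∀ i x → x ∈ D i → to g (x̂ x) ∈BF ⊆X (_∈ D i)) →
    (∀ g → g ∈ˡ G → ∀ i → to g (ŷ i) ∈BF ⊆Y (λ j → D j ≡ D i)) →
    (∀ g → g ∈ˡ G → ∀ i j → Incomparable (D i) (D j) → to g (ŷ i) ≢ ŷ i →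
    to g (ŷ j) ≡ ŷ j × (∀ x → x ∈ D j → x ∉ D i → to g (x̂ x) ≡ x̂ x)) →
    ConjunctiveSymmetryBreaker D (AssociatedGroup D Gsyn) (breaker D G)
theorem2 n k D sorted Gsyn isGroup G G⊆Gsyn cond₁ cond₂ cond₃ s =
  let t , st , ts , ψ-true = descend s (lex-wellFounded (measure D s))
  in transposition (interpretations D) (interpretations-≟ D) s t
   , transposition-associated isGroup s t st ts
   , trans (cong ⟦ D ∙ breaker D G ⟧ (swap-a (interpretations D) (interpretations-≟ D) s t)) ψ-true
  where
  open IsAdmissibleGroup isGroup

  -- The fixed length `k` is essential: lexicographic order on lists of unbounded length has
  -- infinite descents.
  lex-wellFounded : WellFounded (_<ₗₑₓ_ {k})
  lex-wellFounded = Lex.<-wellFounded trans (proj₁ <-resp₂-≡) <-wellFounded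

  -- Both directions of `Related` are accumulated along the chain of repairs, as the final
  -- transposition needs both.
  descend : ∀ s → Acc _<ₗₑₓ_ (measure D s) →
    ∃[ t ] (Related D Gsyn s t × Related D Gsyn t s × ⟦ D ∙ breaker D G ⟧ t ≡ true)
  descend s (acc rec) with ⟦ D ∙ breaker D G ⟧ s in ψ-value
  ... | true  =
    let ss = Related-reflexive isGroup s s (λ _ _ → refl) in s , ss , ss , ψ-value
  ... | false =
    let σ , g , i , g∈G , violation = breaker-false⁻ D G s ψ-value
        g∈Gsyn = G⊆Gsyn g g∈G
        open Repair sorted (admissible g∈Gsyn) (admissible (⁻¹-closed g∈Gsyn))
          (cond₁ g g∈G) (cond₂ g g∈G) (cond₃ g g∈G) violation
        t , rt , tr , ψ-true = descend repaired (rec measure-decreases)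
    in t
     , Related-trans isGroup s repaired t (related-repaired isGroup g∈Gsyn) rt
     , Related-trans isGroup t repaired s tr (repaired-related isGroup g∈Gsyn)
     , ψ-true
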